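{- Fix $\alpha\in[\tfrac12,1)$. After any sequence of insert, delete and get operations (with counter-based rebuilding), a SAIT storing $n$ keys with total number of accesses $m$ uses $O(m^{\alpha}\cdot n)$ memory.
   Context: A Generic Self-Adjusting Tree (GSAT) with degree function $D$ for a set of integer keys with access counts $ac_i\ge1$ consists of $m=\sum_i ac_i$, an array of $k\le\lceil D(m)\rceil$ representative keys with their access counts, and $k+1$ child subtrees that are GSATs for the keys lying strictly before the first representative, strictly between consecutive representatives, and strictly after the last; every node stores at least one key. A GSAT is ideal if each child $T_j$ of the root satisfies $m(T_j)\le m/(D(m)+1)$, where $m(T_j)$ is the total access count of keys in $T_j$, and each child is ideal. A SAIT is a GSAT with $D(m)=\sqrt m$ in which each node whose subtree has total access count $m'$ at the time of its construction stores an interpolation array $ID$ of size $\lceil m'^{\alpha}\rceil$ and otherwise $O(D(m'))$ data. Dynamic operations: each node $v$ has a counter $C(v)$ and $im(T_v)$, the value of $m(T_v)$ at the last (re)build of $T_v$; an operation on key $x$ walks the search path, increments counters of visited nodes and the access count of $x$ (insert of an absent key adds a new constant-size node holding $x$ with count 1, delete only marks the key); then the shallowest visited $u$ with $C(u)>im(T_u)/4$ (if any) has $T_u$ rebuilt into an ideal SAIT of its unmarked keys, resetting counters to $0$ and $im$ values. -}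

module Defs where

open import Algebra.Definitions.RawSemiring using (_^_)
open import Data.Bool using (Bool; true; false)
open import Data.Bool.Properties using () renaming (_≟_ to _≟ᵇ_)
open import Data.Integer using (ℤ; +_)
import Data.Integer as ℤ
import Data.Integer.Properties as ℤ
open import Data.List using (List; []; _∷_; _++_; map; sum; length; filter)
open import Data.List.Relation.Unary.All using (All)
open import Data.Nat using (ℕ; suc)
import Data.Nat as ℕ
open import Data.Product using (_×_; _,_; ∃-syntax)
open import Data.Rational using (ℚ; 0ℚ; _/_; _<_; _+_; _*_; +-*-rawSemiring)
open import Data.Sum using (_⊎_)
open import Data.Unit using (⊤)
open import Relation.Binary.Definitions using (tri<; tri≈; tri>)
open import Relation.Binary.PropositionalEquality using (_≡_)
open import Relation.Nullary using (¬_)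

------------------------------------------------------------------------
-- Real numbers as two-sided Dedekind cuts of ℚ

-- L x q means q < x and U x q means x < q.  The operations below act on the
-- raw cuts; on Dedekind reals (in the stated ranges) they give the usual reals.

record Cut : Set₁ where
  field
    L U : ℚ → Set

open Cut public

record IsReal (x : Cut) : Set where
  field
    L-inhabited : ∃[ q ] L x q
    U-inhabited : ∃[ q ] U x q
    L-closed    : ∀ {p q} → p < q → L x q → L x p
    U-closed    : ∀ {p q} → p < q → U x p → U x q
    L-open      : ∀ {p} → L x p → ∃[ q ] (p < q × L x q)
    U-open      : ∀ {q} → U x q → ∃[ p ] (p < q × U x p)
    disjoint    : ∀ {q} → ¬ (L x q × U x q)
    located     : ∀ {p q} → p < q → L x p ⊎ U x q

infix 4 _<ᶜ_ _≤ᶜ_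

_<ᶜ_ : Cut → Cut → Set
x <ᶜ y = ∃[ q ] (U x q × L y q)

_≤ᶜ_ : Cut → Cut → Set
x ≤ᶜ y = ¬ (y <ᶜ x)

fromℚ : ℚ → Cut
fromℚ r = record { L = λ q → q < r ; U = λ q → r < q }

ℕ→ℚ : ℕ → ℚ
ℕ→ℚ n = + n / 1

fromℕ : ℕ → Cut
fromℕ n = fromℚ (ℕ→ℚ n)

infixl 6 _+ᶜ_
infixl 7 _·ᶜ_ _/ᶜ_
infixr 8 _^ᶜ_ _^ℚ_

_+ᶜ_ : Cut → Cut → Cut
x +ᶜ y = record
  { L = λ q → ∃[ a ] ∃[ b ] (L x a × L y b × q ≡ a + b)
  ; U = λ q → ∃[ a ] ∃[ b ] (U x a × U y b × q ≡ a + b)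
  }

_·ᶜ_ : ℕ → Cut → Cut
k ·ᶜ x = record
  { L = λ q → ∃[ a ] (L x a × q < ℕ→ℚ k * a)
  ; U = λ q → ∃[ a ] (U x a × ℕ→ℚ k * a < q)
  }

-- k / x, for x > 0.
_/ᶜ_ : ℕ → Cut → Cut
k /ᶜ x = record
  { L = λ q → ∃[ a ] (U x a × q * a < ℕ→ℚ k)
  ; U = λ q → ∃[ a ] (0ℚ < a × L x a × ℕ→ℚ k < q * a)
  }

√_ : ℕ → Cut
√ m = record
  { L = λ q → q < 0ℚ ⊎ q * q < ℕ→ℚ m
  ; U = λ q → 0ℚ < q × ℕ→ℚ m < q * q
  }

_^ℚ_ : ℚ → ℕ → ℚ
q ^ℚ n = _^_ +-*-rawSemiring q n

-- m ^ x, for x > 0: the supremum of m ^ r over rationals 0 < r < x and the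
-- infimum of m ^ r over rationals r > x.  With r = a / b, the comparison of q
-- with m ^ r is that of q ^ b with m ^ a.
_^ᶜ_ : ℕ → Cut → Cut
m ^ᶜ x = record
  { L = λ q → q < 0ℚ ⊎
      (∃[ a ] ∃[ b ] (L x (+ suc a / suc b) × q ^ℚ suc b < ℕ→ℚ (m ℕ.^ suc a)))
  ; U = λ q → 0ℚ < q ×
      (∃[ a ] ∃[ b ] (U x (+ suc a / suc b) × ℕ→ℚ (m ℕ.^ suc a) < q ^ℚ suc b))
  }

-- c = ⌈ x ⌉, for x ≥ 0.
IsCeiling : Cut → ℕ → Set
IsCeiling x c = x ≤ᶜ fromℕ c × (∀ d → x ≤ᶜ fromℕ d → c ℕ.≤ d)

------------------------------------------------------------------------
-- Trees

record Entry : Set where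
  constructor entry
  field
    key    : ℤ
    ac     : ℕ
    marked : Bool

open Entry public

record Header : Set where
  field
    C   : ℕ
    im  : ℕ
    ID  : List ℕ
    aux : ℕ        -- number of memory words used by the node besides ID

open Header public

-- A node with representatives e₁ … eₖ and children t₀ … tₖ is
-- node h (t₀ ◂ e₁ ▸ t₁ ◂ e₂ ▸ … ◂ eₖ ▸ last tₖ); empty is the GSAT of no keys.

infixr 5 _◂_▸_

mutual
  data Tree : Set where
    empty : Tree
    node  : Header → Slots → Tree

  data Slots : Set where
    last  : Tree → Slots
    _◂_▸_ : Tree → Entry → Slots → Slots

mutual
  entries : Tree → List Entry
  entries empty      = []
  entries (node _ s) = entriesˢ s

  entriesˢ : Slots → List Entry
  entriesˢ (last t)    = entries t
  entriesˢ (t ◂ e ▸ s) = entries t ++ e ∷ entriesˢ s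

-- Marked keys remain in the tree until a rebuild removes them, and count as
-- stored, both here and in the access total.
numKeys : Tree → ℕ
numKeys t = length (entries t)

total : List Entry → ℕ
total es = sum (map ac es)

m⟨_⟩ : Tree → ℕ
m⟨ t ⟩ = total (entries t)

numReps : Slots → ℕ
numReps (last _)    = 0
numReps (_ ◂ _ ▸ s) = suc (numReps s)

-- The null subtree occupies no memory of its own: the pointer to it is part of
-- the parent's aux.
mutual
  memory : Tree → ℕ
  memory empty      = 0
  memory (node h s) = length (ID h) ℕ.+ aux h ℕ.+ memoryˢ s

  memoryˢ : Slots → ℕ
  memoryˢ (last t)    = memory t
  memoryˢ (t ◂ _ ▸ s) = memory t ℕ.+ memoryˢ s

------------------------------------------------------------------------
-- GSATs, ideal GSATs and SAITs

module _ (D : ℕ → Cut) where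

  mutual
    IsGSAT : Tree → Set
    IsGSAT empty      = ⊤
    IsGSAT (node _ s) =
        1 ℕ.≤ numReps s
      × (∃[ d ] (IsCeiling (D (total (entriesˢ s))) d × numReps s ℕ.≤ d))
      × IsGSATˢ s

    IsGSATˢ : Slots → Set
    IsGSATˢ (last t)    = IsGSAT t
    IsGSATˢ (t ◂ e ▸ s) =
        IsGSAT t
      × All (λ f → key f ℤ.< key e) (entries t)
      × 1 ℕ.≤ ac e
      × All (λ f → key e ℤ.< key f) (entriesˢ s)
      × IsGSATˢ s

  IsLight : ℕ → Tree → Set
  IsLight m t = fromℕ m⟨ t ⟩ ≤ᶜ m /ᶜ (D m +ᶜ fromℕ 1)

  mutual
    IsIdeal : Tree → Set
    IsIdeal empty      = ⊤
    IsIdeal (node _ s) = IsIdealˢ (total (entriesˢ s)) s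

    -- The first argument is the access total of the enclosing node.
    IsIdealˢ : ℕ → Slots → Set
    IsIdealˢ m (last t)    = IsLight m t × IsIdeal t
    IsIdealˢ m (t ◂ _ ▸ s) = IsLight m t × IsIdeal t × IsIdealˢ m s

-- A is the constant hidden in the O(D(m')) bound on the data of a node besides
-- its interpolation array.
module _ (α : Cut) (A : ℕ) where

  record IsFreshHeader (m : ℕ) (h : Header) : Set where
    field
      C≡0     : C h ≡ 0
      im≡m    : im h ≡ m
      ID-size : IsCeiling (m ^ᶜ α) (length (ID h))
      aux-≤   : fromℕ (aux h) ≤ᶜ A ·ᶜ √ m

  mutual
    AllFresh : Tree → Set
    AllFresh empty      = ⊤
    AllFresh (node h s) = IsFreshHeader (total (entriesˢ s)) h × AllFreshˢ s

    AllFreshˢ : Slots → Set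
    AllFreshˢ (last t)    = AllFresh t
    AllFreshˢ (t ◂ _ ▸ s) = AllFresh t × AllFreshˢ s

  record IsIdealSAIT (t : Tree) : Set where
    field
      gsat  : IsGSAT √_ t
      ideal : IsIdeal √_ t
      fresh : AllFresh t

  IsInitial : Tree → Set
  IsInitial t = IsIdealSAIT t × All (λ e → marked e ≡ false) (entries t)

  -- t′ may be any ideal SAIT of the unmarked keys of t with their current
  -- access counts; since in-order lists are sorted, equality of lists is
  -- equality of sets.
  record IsRebuildOf (t t′ : Tree) : Set where
    field
      idealSAIT : IsIdealSAIT t′
      same-keys : entries t′ ≡ filter (λ e → marked e ≟ᵇ false) (entries t)

------------------------------------------------------------------------
-- Dynamic operations

data Kind : Set where
  insert delete get : Kind

Operation : Set
Operation = Kind × ℤ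

-- The effect on the entry of the key when it is present, marked or not.
hit : Kind → Entry → Entry
hit insert (entry k c _) = entry k (suc c) false
hit delete (entry k c _) = entry k (suc c) true
hit get    (entry k c b) = entry k (suc c) b

visit : Header → Header
visit h = record h { C = suc (C h) }

-- v is the node attached when an insertion does not find its key.
mutual
  walk : Operation → Tree → Tree → Tree
  walk (insert , _) v empty      = v
  walk (delete , _) v empty      = empty
  walk (get    , _) v empty      = empty
  walk o            v (node h s) = node (visit h) (walkˢ o v s)

  walkˢ : Operation → Tree → Slots → Slots
  walkˢ o v (last t) = last (walk o v t)
  walkˢ o@(κ , x) v (t ◂ e ▸ s) with ℤ.<-cmp x (key e)
  ... | tri< _ _ _ = walk o v t ◂ e ▸ s
  ... | tri≈ _ _ _ = t ◂ hit κ e ▸ s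
  ... | tri> _ _ _ = t ◂ e ▸ walkˢ o v s

-- C > im / 4
Overfull : Header → Set
Overfull h = im h ℕ.< 4 ℕ.* C h

-- B bounds the size of a node created by an insertion.
data IsNewNode (B : ℕ) (x : ℤ) : Tree → Set where
  newNode : ∀ {h} → C h ≡ 0 → im h ≡ 1 → length (ID h) ℕ.+ aux h ℕ.≤ B →
            IsNewNode B x (node h (empty ◂ entry x 1 false ▸ last empty))

module _ (α : Cut) (A : ℕ) where

  -- Rebalance x t t′: t′ results from t by rebuilding the subtree of the
  -- shallowest overfull node on the search path of x, if there is one.
  mutual
    data Rebalance (x : ℤ) : Tree → Tree → Set where
      stop    : Rebalance x empty empty
      rebuild : ∀ {h s t′} → Overfull h → IsRebuildOf α A (node h s) t′ →
                Rebalance x (node h s) t′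
      descend : ∀ {h s s′} → ¬ Overfull h → Rebalanceˢ x s s′ →
                Rebalance x (node h s) (node h s′)

    data Rebalanceˢ (x : ℤ) : Slots → Slots → Set where
      last  : ∀ {t t′} → Rebalance x t t′ → Rebalanceˢ x (last t) (last t′)
      left  : ∀ {t t′ e s} → x ℤ.< key e → Rebalance x t t′ →
              Rebalanceˢ x (t ◂ e ▸ s) (t′ ◂ e ▸ s)
      found : ∀ {t e s} → x ≡ key e → Rebalanceˢ x (t ◂ e ▸ s) (t ◂ e ▸ s)
      right : ∀ {t e s s′} → key e ℤ.< x → Rebalanceˢ x s s′ →
              Rebalanceˢ x (t ◂ e ▸ s) (t ◂ e ▸ s′)

module _ (α : Cut) (A B : ℕ) where

  data Step : Operation → Tree → Tree → Set where
    step : ∀ {κ x t v t′} → IsNewNode B x v →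
           Rebalance α A x (walk (κ , x) v t) t′ → Step (κ , x) t t′

  data Run : List Operation → Tree → Tree → Set where
    []  : ∀ {t} → Run [] t t
    _∷_ : ∀ {o os t t′ t″} → Step o t t′ → Run os t′ t″ → Run (o ∷ os) t t″

{-# OPTIONS --safe #-}
module Submission where

-- A node built with total access count M and k representatives of total access
-- count R has memory O(M ^ α).  Its k + 1 children weigh O(√M) each, so either
-- k = Ω(√M) or R = Ω(M); as 1 ≤ k ≤ R, in both cases M = O(k R), and since
-- ½ ≤ α < 1 the memory of the node is O(k R ^ α).  The representatives stay in
-- the tree until the node is rebuilt and their access counts only grow, so this
-- bound survives all operations.  Summing it over the nodes gives O(n m ^ α).

open import Defs
open import Data.Empty using (⊥-elim)
open import Data.Integer as ℤ using (-[1+_])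
import Data.Integer.Properties as ℤ
open import Data.List using (List; []; _∷_; _++_; length)
open import Data.List.Properties using (length-++)
open import Data.Nat using (ℕ; zero; suc; _+_; _*_; _^_; _≤_; _<_; z≤n; s≤s; NonZero; >-nonZero; _≤?_; _/_; _%_)
open import Data.Nat.DivMod using (m/n*n≤m; m≡m%n+[m/n]*n; m%n<n)
open import Data.Nat.Properties
open import Data.Nat.Tactic.RingSolver using (solve-∀)
open import Data.Product using (_×_; _,_; proj₁; proj₂; ∃-syntax)
open import Data.Rational using (mkℚ; ½; 0ℚ; 1ℚ; toℚᵘ; nonNegative)
import Data.Rational as ℚ
import Data.Rational.Properties as ℚ
open import Data.Rational.Unnormalised as ℚᵘ using (mkℚᵘ; *<*)
import Data.Rational.Unnormalised.Properties as ℚᵘ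
open import Data.Sum using (inj₁; inj₂)
open import Data.Unit using (⊤; tt)
open import Relation.Binary.Definitions using (tri<; tri≈; tri>)
open import Relation.Binary.PropositionalEquality using (_≡_; refl; sym; trans; cong; subst; subst₂)
open import Relation.Nullary using (yes; no)

-- Rationals

/-mono-< : ∀ a b c d → a * suc d < c * suc b → ℤ.+ a ℚ./ suc b ℚ.< ℤ.+ c ℚ./ suc d
/-mono-< a b c d ad<cb = ℚ.toℚᵘ-cancel-<
  (ℚᵘ.<-respˡ-≃ (ℚᵘ.≃-sym (ℚ.toℚᵘ-fromℚᵘ (mkℚᵘ (ℤ.+ a) b)))
  (ℚᵘ.<-respʳ-≃ (ℚᵘ.≃-sym (ℚ.toℚᵘ-fromℚᵘ (mkℚᵘ (ℤ.+ c) d)))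
  (*<* (subst₂ ℤ._<_ (ℤ.pos-* a (suc d)) (ℤ.pos-* c (suc b)) (ℤ.+<+ ad<cb)))))

/-mono-≤ : ∀ a b c d → a * suc d ≤ c * suc b → ℤ.+ a ℚ./ suc b ℚ.≤ ℤ.+ c ℚ./ suc d
/-mono-≤ a b c d ad≤cb = ℚ.toℚᵘ-cancel-≤
  (ℚᵘ.≤-respˡ-≃ (ℚᵘ.≃-sym (ℚ.toℚᵘ-fromℚᵘ (mkℚᵘ (ℤ.+ a) b)))
  (ℚᵘ.≤-respʳ-≃ (ℚᵘ.≃-sym (ℚ.toℚᵘ-fromℚᵘ (mkℚᵘ (ℤ.+ c) d)))
  (ℚᵘ.*≤* (subst₂ ℤ._≤_ (ℤ.pos-* a (suc d)) (ℤ.pos-* c (suc b)) (ℤ.+≤+ ad≤cb)))))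

ℕ→ℚ-mono-< : ∀ {m n} → m < n → ℕ→ℚ m ℚ.< ℕ→ℚ n
ℕ→ℚ-mono-< {m} {n} m<n = /-mono-< m 0 n 0 (*-monoˡ-< 1 m<n)

ℕ→ℚ-mono-≤ : ∀ {m n} → m ≤ n → ℕ→ℚ m ℚ.≤ ℕ→ℚ n
ℕ→ℚ-mono-≤ {m} {n} m≤n = /-mono-≤ m 0 n 0 (*-monoˡ-≤ 1 m≤n)

ℕ→ℚ-cancel-< : ∀ {m n} → ℕ→ℚ m ℚ.< ℕ→ℚ n → m < n
ℕ→ℚ-cancel-< m<n = ≰⇒> λ n≤m → ℚ.<-irrefl refl (ℚ.<-≤-trans m<n (ℕ→ℚ-mono-≤ n≤m))

ℕ→ℚ-* : ∀ m n → ℕ→ℚ m ℚ.* ℕ→ℚ n ≡ ℕ→ℚ (m * n)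
ℕ→ℚ-* m n = ℚ.toℚᵘ-injective (begin
  toℚᵘ (ℕ→ℚ m ℚ.* ℕ→ℚ n)             ≈⟨ ℚ.toℚᵘ-homo-* (ℕ→ℚ m) (ℕ→ℚ n) ⟩
  toℚᵘ (ℕ→ℚ m) ℚᵘ.* toℚᵘ (ℕ→ℚ n)     ≈⟨ ℚᵘ.*-cong (ℚ.toℚᵘ-fromℚᵘ (mkℚᵘ (ℤ.+ m) 0)) (ℚ.toℚᵘ-fromℚᵘ (mkℚᵘ (ℤ.+ n) 0)) ⟩
  mkℚᵘ (ℤ.+ m ℤ.* ℤ.+ n) 0               ≡⟨ cong (λ i → mkℚᵘ i 0) (sym (ℤ.pos-* m n)) ⟩
  mkℚᵘ (ℤ.+ (m * n)) 0                 ≈⟨ ℚ.toℚᵘ-fromℚᵘ (mkℚᵘ (ℤ.+ (m * n)) 0) ⟨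
  toℚᵘ (ℕ→ℚ (m * n))                 ∎)
  where
  open import Relation.Binary.Reasoning.Setoid ℚᵘ.≃-setoid

ℕ→ℚ-^ : ∀ m n → ℕ→ℚ m ^ℚ n ≡ ℕ→ℚ (m ^ n)
ℕ→ℚ-^ m zero    = refl
ℕ→ℚ-^ m (suc n) = trans (cong (ℕ→ℚ m ℚ.*_) (ℕ→ℚ-^ m n)) (ℕ→ℚ-* m (m ^ n))

ℕ→ℚ-nonNeg : ∀ n → 0ℚ ℚ.≤ ℕ→ℚ n
ℕ→ℚ-nonNeg n = ℕ→ℚ-mono-≤ {0} {n} z≤n

*-mono-≤-nonNeg : ∀ {p q r s} → 0ℚ ℚ.≤ p → p ℚ.≤ q → 0ℚ ℚ.≤ r → r ℚ.≤ s → p ℚ.* r ℚ.≤ q ℚ.* s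
*-mono-≤-nonNeg {p} {q} {r} {s} 0≤p p≤q 0≤r r≤s = ℚ.≤-trans
  (ℚ.*-monoʳ-≤-nonNeg r {{nonNegative 0≤r}} p≤q)
  (ℚ.*-monoˡ-≤-nonNeg q {{nonNegative (ℚ.≤-trans 0≤p p≤q)}} r≤s)

^ℚ-nonNeg : ∀ {q} n → 0ℚ ℚ.≤ q → 0ℚ ℚ.≤ q ^ℚ n
^ℚ-nonNeg zero    0≤q = ℕ→ℚ-nonNeg 1
^ℚ-nonNeg (suc n) 0≤q = *-mono-≤-nonNeg ℚ.≤-refl 0≤q ℚ.≤-refl (^ℚ-nonNeg n 0≤q)

^ℚ-monoˡ-≤ : ∀ {p q} n → 0ℚ ℚ.≤ p → p ℚ.≤ q → p ^ℚ n ℚ.≤ q ^ℚ n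
^ℚ-monoˡ-≤ zero    0≤p p≤q = ℚ.≤-refl
^ℚ-monoˡ-≤ (suc n) 0≤p p≤q = *-mono-≤-nonNeg 0≤p p≤q (^ℚ-nonNeg n 0≤p) (^ℚ-monoˡ-≤ n 0≤p p≤q)

floor : ∀ q → 0ℚ ℚ.≤ q → ∃[ f ] (ℕ→ℚ f ℚ.≤ q × q ℚ.≤ ℕ→ℚ (suc f))
floor q@(mkℚ -[1+ n ] d _) 0≤q = ⊥-elim (ℚ.<-irrefl refl (ℚ.<-≤-trans (ℚ.negative⁻¹ q) 0≤q))
floor q@(mkℚ (ℤ.+ n) d _) 0≤q =
  f , subst (ℕ→ℚ f ℚ.≤_) eq (/-mono-≤ f 0 n d (≤-trans (m/n*n≤m n (suc d)) (≤-reflexive (sym (*-identityʳ n)))))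
    , subst (ℚ._≤ ℕ→ℚ (suc f)) eq (/-mono-≤ n d (suc f) 0 (begin
        n * 1                       ≡⟨ *-identityʳ n ⟩
        n                           ≡⟨ m≡m%n+[m/n]*n n (suc d) ⟩
        n % suc d + f * suc d       ≤⟨ +-monoˡ-≤ (f * suc d) (<⇒≤ (m%n<n n (suc d))) ⟩
        suc f * suc d               ∎))
  where
  open ≤-Reasoning
  f = n / suc d
  eq = ℚ.fromℚᵘ-toℚᵘ q

-- Natural numbers

^-distribʳ-* : ∀ m n o → (m * n) ^ o ≡ m ^ o * n ^ o
^-distribʳ-* m n zero    = refl
^-distribʳ-* m n (suc o) = trans (cong (m * n *_) (^-distribʳ-* m n o)) (lemma m n (m ^ o) (n ^ o))
  where
  lemma : ∀ a b c d → a * b * (c * d) ≡ a * c * (b * d)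
  lemma = solve-∀

^-cancelˡ-≤ : ∀ {m n} o .{{_ : NonZero o}} → m ^ o ≤ n ^ o → m ≤ n
^-cancelˡ-≤ o m^o≤n^o = ≮⇒≥ λ n<m → <⇒≱ (^-monoˡ-< o n<m) m^o≤n^o

1≤^⇒1≤ : ∀ n o → 1 ≤ n ^ suc o → 1 ≤ n
1≤^⇒1≤ (suc n) o _ = s≤s z≤n

-- The root is rounded to the largest `s` whose square is strictly below the argument: only such an
-- `s` lies in the lower cut of `√_`, against which lightness is tested.
strict-sqrt : ∀ m → ∃[ s ] (s * s < suc m × suc m ≤ suc s * suc s)
strict-sqrt zero    = 0 , s≤s z≤n , s≤s z≤n
strict-sqrt (suc m) with strict-sqrt m
... | s , s²<m , m≤[1+s]² with suc (suc m) ≤? suc s * suc s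
...   | yes m<[1+s]² = s , m<n⇒m<1+n s²<m , m<[1+s]²
...   | no  m≮[1+s]² = suc s , ≰⇒> m≮[1+s]² , (begin
          suc (suc m)                 ≤⟨ s≤s m≤[1+s]² ⟩
          suc (suc s * suc s)         ≤⟨ *-mono-< (n<1+n (suc s)) (n<1+n (suc s)) ⟩
          suc (suc s) * suc (suc s)   ∎)
  where open ≤-Reasoning

-- Representatives

repWeight : Slots → ℕ
repWeight (last _)    = 0
repWeight (_ ◂ e ▸ s) = ac e + repWeight s

total-++ : ∀ es fs → total (es ++ fs) ≡ total es + total fs
total-++ []       fs = refl
total-++ (e ∷ es) fs = trans (cong (ac e +_) (total-++ es fs)) (sym (+-assoc (ac e) (total es) (total fs)))

repWeight≤total : ∀ s → repWeight s ≤ total (entriesˢ s)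
repWeight≤total (last _)    = z≤n
repWeight≤total (t ◂ e ▸ s) rewrite total-++ (entries t) (e ∷ entriesˢ s) =
  ≤-trans (+-monoʳ-≤ (ac e) (repWeight≤total s)) (m≤n+m _ (m⟨ t ⟩))

module _ {D : ℕ → Cut} where

  numReps≤repWeight : ∀ s → IsGSATˢ D s → numReps s ≤ repWeight s
  numReps≤repWeight (last _)    _                   = z≤n
  numReps≤repWeight (_ ◂ _ ▸ s) (_ , _ , 1≤ac , _ , g) = +-mono-≤ 1≤ac (numReps≤repWeight s g)

numReps-walkˢ : ∀ o v s → numReps (walkˢ o v s) ≡ numReps s
numReps-walkˢ o       v (last _)    = refl
numReps-walkˢ (κ , x) v (_ ◂ e ▸ s) with ℤ.<-cmp x (key e)
... | tri< _ _ _ = refl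
... | tri≈ _ _ _ = refl
... | tri> _ _ _ = cong suc (numReps-walkˢ (κ , x) v s)

ac≤ac-hit : ∀ κ e → ac e ≤ ac (hit κ e)
ac≤ac-hit insert e = n≤1+n (ac e)
ac≤ac-hit delete e = n≤1+n (ac e)
ac≤ac-hit get    e = n≤1+n (ac e)

-- Every kind of operation raises the count of the key it hits; a deletion merely marks it, so no
-- weight leaves the node.
repWeight-walkˢ : ∀ o v s → repWeight s ≤ repWeight (walkˢ o v s)
repWeight-walkˢ o       v (last _)    = z≤n
repWeight-walkˢ (κ , x) v (_ ◂ e ▸ s) with ℤ.<-cmp x (key e)
... | tri< _ _ _ = ≤-refl
... | tri≈ _ _ _ = +-monoˡ-≤ (repWeight s) (ac≤ac-hit κ e)
... | tri> _ _ _ = +-monoʳ-≤ (ac e) (repWeight-walkˢ (κ , x) v s)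

module _ {α : Cut} {A : ℕ} where

  numReps-rebalanceˢ : ∀ {x s s′} → Rebalanceˢ α A x s s′ → numReps s′ ≡ numReps s
  numReps-rebalanceˢ (last _)    = refl
  numReps-rebalanceˢ (left _ _)  = refl
  numReps-rebalanceˢ (found _)   = refl
  numReps-rebalanceˢ (right _ ρ) = cong suc (numReps-rebalanceˢ ρ)

  repWeight-rebalanceˢ : ∀ {x s s′} → Rebalanceˢ α A x s s′ → repWeight s′ ≡ repWeight s
  repWeight-rebalanceˢ (last _)            = refl
  repWeight-rebalanceˢ (left _ _)          = refl
  repWeight-rebalanceˢ (found _)           = refl
  repWeight-rebalanceˢ (right {e = e} _ ρ) = cong (ac e +_) (repWeight-rebalanceˢ ρ)

-- Total weight of an ideal node

light⇒m*s≤M+s : ∀ {M s} t → IsLight √_ M t → s * s < M → m⟨ t ⟩ * s ≤ M + s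
light⇒m*s≤M+s {M} {zero}  t light s²<M = ≤-trans (≤-reflexive (*-zeroʳ m⟨ t ⟩)) z≤n
light⇒m*s≤M+s {M} {s@(suc _)} t light s²<M with m⟨ t ⟩
... | zero  = z≤n
... | suc m = ≤-trans (+-monoʳ-≤ s m*s≤M) (≤-reflexive (+-comm s M))
  where
  -- Otherwise `m` lies above M / (√M + 1), since `s = s + 0` is in the lower cut of the
  -- denominator. The cut order being strict, the integer witness is one less than the weight
  -- `suc m`, which costs the summand `s`.
  m*s≤M : m * s ≤ M
  m*s≤M = ≮⇒≥ λ M<m*s → light
    ( ℕ→ℚ m
    , (ℕ→ℚ s , ℕ→ℚ-mono-< {0} {s} (s≤s z≤n)
      , (ℕ→ℚ s , 0ℚ , inj₂ (subst (ℚ._< ℕ→ℚ M) (sym (ℕ→ℚ-* s s)) (ℕ→ℚ-mono-< s²<M))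
        , ℕ→ℚ-mono-< {0} {1} (s≤s z≤n) , sym (ℚ.+-identityʳ (ℕ→ℚ s)))
      , subst (ℕ→ℚ M ℚ.<_) (sym (ℕ→ℚ-* m s)) (ℕ→ℚ-mono-< M<m*s))
    , ℕ→ℚ-mono-< (n<1+n m))

-- Lightness is summed over all children, one more than there are representatives. `M` is kept apart
-- from the total of `s` because the induction runs over suffixes of the slots of one node.
ideal⇒total*x≤ : ∀ {M x} s → IsIdealˢ √_ M s → x * x < M →
  total (entriesˢ s) * x ≤ repWeight s * x + suc (numReps s) * (M + x)
ideal⇒total*x≤ {M} {x} (last t) (light , _) x²<M =
  ≤-trans (light⇒m*s≤M+s {M} {x} t light x²<M) (≤-reflexive (sym (*-identityˡ (M + x))))
ideal⇒total*x≤ {M} {x} (t ◂ e ▸ s) (light , _ , ideal) x²<M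
  rewrite total-++ (entries t) (e ∷ entriesˢ s) = begin
    (m⟨ t ⟩ + (ac e + total (entriesˢ s))) * x
      ≡⟨ lemma₁ m⟨ t ⟩ (ac e) (total (entriesˢ s)) x ⟩
    m⟨ t ⟩ * x + (ac e * x + total (entriesˢ s) * x)
      ≤⟨ +-mono-≤ (light⇒m*s≤M+s {M} {x} t light x²<M) (+-monoʳ-≤ (ac e * x) (ideal⇒total*x≤ s ideal x²<M)) ⟩
    (M + x) + (ac e * x + (repWeight s * x + suc (numReps s) * (M + x)))
      ≡⟨ lemma₂ (M + x) (ac e) (repWeight s) x (suc (numReps s)) ⟩
    (ac e + repWeight s) * x + suc (suc (numReps s)) * (M + x) ∎
  where
  open ≤-Reasoning
  lemma₁ : ∀ a b c x → (a + (b + c)) * x ≡ a * x + (b * x + c * x)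
  lemma₁ = solve-∀
  lemma₂ : ∀ a b c x k → a + (b * x + (c * x + k * a)) ≡ (b + c) * x + suc k * a
  lemma₂ = solve-∀

-- Either the node has about √M representatives, so that M = O(k²), or its
-- k + 1 light children leave half of the weight to the representatives.
ideal⇒total≤ : ∀ s → IsGSATˢ √_ s → 1 ≤ numReps s → IsIdealˢ √_ (total (entriesˢ s)) s →
  total (entriesˢ s) ≤ 64 * numReps s * repWeight s
ideal⇒total≤ s gsat 1≤k ideal with total (entriesˢ s) in eq
... | zero  = z≤n
... | suc M with strict-sqrt M
...   | x , x²<M , M≤[1+x]² with 4 * suc k ≤? x
  where k = numReps s
-- After scaling by 8 the share of the children is at most `x * (4 * suc M)`, half of the left side.
-- Cancelling it leaves the share of the representatives; the factor `64 * k` is put in to match the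
-- other case.
...     | yes 4k≤x = *-cancelʳ-≤ _ _ (4 * x) {{>-nonZero (*-mono-≤ {1} {4} (s≤s z≤n) 1≤x)}} (+-cancelʳ-≤ _ _ _ (begin
            suc M * (4 * x) + suc M * (4 * x)      ≡⟨ lemma₁ (suc M) x ⟩
            suc M * x * 8                          ≤⟨ *-monoˡ-≤ 8 (subst (λ m → m * x ≤ R * x + suc k * (suc M + x)) eq (ideal⇒total*x≤ s ideal x²<M)) ⟩
            (R * x + suc k * (suc M + x)) * 8      ≤⟨ *-monoˡ-≤ 8 (+-monoʳ-≤ (R * x) (*-monoʳ-≤ (suc k) (+-monoʳ-≤ (suc M) x≤M))) ⟩
            (R * x + suc k * (suc M + suc M)) * 8  ≡⟨ lemma₂ R x (suc k) (suc M) ⟩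
            8 * R * x + 4 * suc k * (4 * suc M)    ≤⟨ +-mono-≤ 8Rx≤ (*-monoˡ-≤ (4 * suc M) 4k≤x) ⟩
            64 * k * R * (4 * x) + x * (4 * suc M) ≡⟨ cong (64 * k * R * (4 * x) +_) (lemma₃ x (suc M)) ⟩
            64 * k * R * (4 * x) + suc M * (4 * x) ∎))
  where
  open ≤-Reasoning
  k = numReps s
  R = repWeight s
  1≤x : 1 ≤ x
  1≤x = ≤-trans (s≤s z≤n) 4k≤x
  x≤M : x ≤ suc M
  x≤M = ≤-trans (m≤m*n x x {{>-nonZero 1≤x}}) (<⇒≤ x²<M)
  lemma₁ : ∀ m x → m * (4 * x) + m * (4 * x) ≡ m * x * 8
  lemma₁ = solve-∀
  lemma₂ : ∀ r x k m → (r * x + k * (m + m)) * 8 ≡ 8 * r * x + 4 * k * (4 * m)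
  lemma₂ = solve-∀
  lemma₃ : ∀ x m → x * (4 * m) ≡ m * (4 * x)
  lemma₃ = solve-∀
  8Rx≤ : 8 * R * x ≤ 64 * k * R * (4 * x)
  8Rx≤ = *-mono-≤ (*-monoˡ-≤ R (*-mono-≤ {8} {64} (m≤m+n 8 56) 1≤k)) (m≤n*m x 4)
-- Here `suc x ≤ 4 * suc k ≤ 8 * k`, whose square yields the constant 64; one factor `k` is then
-- traded for the weight of the representatives.
...     | no 4k≰x = begin
            suc M                           ≤⟨ M≤[1+x]² ⟩
            suc x * suc x                   ≤⟨ *-mono-≤ 1+x≤8k 1+x≤8k ⟩
            8 * k * (8 * k)                 ≡⟨ lemma k ⟩
            64 * k * k                      ≤⟨ *-monoʳ-≤ (64 * k) (numReps≤repWeight s gsat) ⟩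
            64 * k * repWeight s            ∎
  where
  open ≤-Reasoning
  k = numReps s
  lemma : ∀ k → 8 * k * (8 * k) ≡ 64 * k * k
  lemma = solve-∀
  lemma′ : ∀ k → 4 * (k + k) ≡ 8 * k
  lemma′ = solve-∀
  1+x≤8k : suc x ≤ 8 * k
  1+x≤8k = ≤-trans (≰⇒> 4k≰x) (≤-trans (*-monoʳ-≤ 4 (+-monoˡ-≤ k 1≤k)) (≤-reflexive (lemma′ k)))

-- Since `M < b * b`, `b` is in the upper cut of √M. If `A * b < x`, a rational strictly between
-- them would refute the hypothesis.
≤ᶜA·√⇒≤A*b : ∀ {x A M} b → fromℕ x ≤ᶜ A ·ᶜ √ M → M < b * b → x ≤ A * b
≤ᶜA·√⇒≤A*b {x} {A} {M} b@(suc _) x≤A√M M<b² = ≮⇒≥ λ A*b<x →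
  let q , A*b<q , q<x = ℚ.<-dense (ℕ→ℚ-mono-< A*b<x) in
  x≤A√M (q
    , (ℕ→ℚ b , (ℕ→ℚ-mono-< {0} {b} (s≤s z≤n) , subst (ℕ→ℚ M ℚ.<_) (sym (ℕ→ℚ-* b b)) (ℕ→ℚ-mono-< M<b²))
      , subst (ℚ._< q) (sym (ℕ→ℚ-* A b)) A*b<q)
    , q<x)

-- Powers with exponent α

module _ (α : Cut) (real : IsReal α) where

  open IsReal real

  -- x ≤ c · R ^ α up to a factor 2, as R ^ α is the infimum of R ^ (p / r)
  -- over the rationals p / r > α, and N ranges over the integers ≥ R ^ (p / r).
  PowerBound : ℕ → ℕ → ℕ → Set
  PowerBound x c R = ∀ N p r → U α (ℤ.+ suc p ℚ./ suc r) → R ^ suc p ≤ N ^ suc r → x ≤ c * N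

  -- A larger weight admits fewer `N`; this is how the bound outlives growing access counts.
  PowerBound-monoʳ : ∀ {x c R R′} → R ≤ R′ → PowerBound x c R → PowerBound x c R′
  PowerBound-monoʳ R≤R′ bound N p r Uα R′^p≤N^r =
    bound N p r Uα (≤-trans (^-monoˡ-≤ (suc p) R≤R′) R′^p≤N^r)

  PowerBound-monoˡ : ∀ {x c c′ R} → c ≤ c′ → PowerBound x c R → PowerBound x c′ R
  PowerBound-monoˡ c≤c′ bound N p r Uα R^p≤N^r = ≤-trans (bound N p r Uα R^p≤N^r) (*-monoˡ-≤ N c≤c′)

  L-U-ordered : ∀ p r p′ r′ → L α (ℤ.+ suc p ℚ./ suc r) → U α (ℤ.+ suc p′ ℚ./ suc r′) →
    suc p * suc r′ ≤ suc p′ * suc r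
  L-U-ordered p r p′ r′ Lα Uα = ≮⇒≥ λ lt →
    disjoint (Lα , U-closed (/-mono-< (suc p′) r′ (suc p) r lt) Uα)

  -- By minimality of the ceiling it suffices that M ^ α does not exceed `d`. A lower exponent
  -- refuting this is at most the given upper one, so raising both inequalities to a common exponent
  -- makes a power of `d` smaller than itself.
  ceiling≤ : ∀ {M c} d p r → IsCeiling (M ^ᶜ α) c → U α (ℤ.+ suc p ℚ./ suc r) →
    1 ≤ d → M ^ suc p ≤ d ^ suc r → c ≤ d
  ceiling≤ {M} {c} d p r (_ , minimal) Uα 1≤d M^p≤d^r = minimal d λ where
      (q , d<q , inj₁ q<0) →
        ℚ.<-irrefl refl (ℚ.≤-<-trans (ℕ→ℚ-nonNeg d) (ℚ.<-trans d<q q<0))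
      (q , d<q , inj₂ (p′ , r′ , Lα , q^r′<M^p′)) →
        let
          d^r′<M^p′ : d ^ suc r′ < M ^ suc p′
          d^r′<M^p′ = ℕ→ℚ-cancel-< (ℚ.≤-<-trans
            (ℚ.≤-trans (ℚ.≤-reflexive (sym (ℕ→ℚ-^ d (suc r′))))
                       (^ℚ-monoˡ-≤ (suc r′) (ℕ→ℚ-nonNeg d) (ℚ.<⇒≤ d<q)))
            q^r′<M^p′)
        in <-irrefl refl (begin-strict
          d ^ (suc r′ * suc p)       ≡⟨ ^-*-assoc d (suc r′) (suc p) ⟨
          (d ^ suc r′) ^ suc p       <⟨ ^-monoˡ-< (suc p) d^r′<M^p′ ⟩
          (M ^ suc p′) ^ suc p       ≡⟨ ^-*-assoc M (suc p′) (suc p) ⟩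
          M ^ (suc p′ * suc p)       ≡⟨ cong (M ^_) (*-comm (suc p′) (suc p)) ⟩
          M ^ (suc p * suc p′)       ≡⟨ ^-*-assoc M (suc p) (suc p′) ⟨
          (M ^ suc p) ^ suc p′       ≤⟨ ^-monoˡ-≤ (suc p′) M^p≤d^r ⟩
          (d ^ suc r) ^ suc p′       ≡⟨ ^-*-assoc d (suc r) (suc p′) ⟩
          d ^ (suc r * suc p′)       ≡⟨ cong (d ^_) (*-comm (suc r) (suc p′)) ⟩
          d ^ (suc p′ * suc r)       ≤⟨ ^-monoʳ-≤ d {{>-nonZero 1≤d}} (L-U-ordered p′ r′ p r Lα Uα) ⟩
          d ^ (suc p * suc r′)       ≡⟨ cong (d ^_) (*-comm (suc p) (suc r′)) ⟩
          d ^ (suc r′ * suc p)       ∎)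
    where open ≤-Reasoning

  -- A rational `a` above R ^ α with floor `f` makes `suc f` an admissible `N`. As `f ≥ 1`,
  -- `suc f ≤ 2 * f ≤ 2 * a`: the factor 2 pays for rounding up.
  PowerBound⇒≤ᶜ : ∀ {x c R} → 1 ≤ R → PowerBound x c R → fromℕ x ≤ᶜ (2 * c) ·ᶜ (R ^ᶜ α)
  PowerBound⇒≤ᶜ {x} {c} {R} 1≤R bound (q , (a , (0<a , p , r , Uα , R^p<a^r) , 2ca<q) , q<x)
    with floor a (ℚ.<⇒≤ 0<a)
  ... | f , f≤a , a≤1+f with R^p<[1+f]^r
    where
    R^p<[1+f]^r : R ^ suc p < suc f ^ suc r
    R^p<[1+f]^r = ℕ→ℚ-cancel-< (ℚ.<-≤-trans R^p<a^r
      (ℚ.≤-trans (^ℚ-monoˡ-≤ (suc r) (ℚ.<⇒≤ 0<a) a≤1+f) (ℚ.≤-reflexive (ℕ→ℚ-^ (suc f) (suc r)))))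
  -- Floor 0 would put a power of `R ≥ 1` strictly below 1.
  PowerBound⇒≤ᶜ {x} {c} {R} 1≤R bound (_ , (_ , (_ , p , r , _) , _) , _) | zero , _ | R^p<1^r =
    <⇒≱ R^p<1^r (≤-trans (≤-reflexive (^-zeroˡ (suc r))) (m^n>0 R {{>-nonZero 1≤R}} (suc p)))
  PowerBound⇒≤ᶜ {x} {c} {R} 1≤R bound (q , (a , (0<a , p , r , Uα , R^p<a^r) , 2ca<q) , q<x)
      | f@(suc g) , f≤a , _ | R^p<[1+f]^r =
    ℚ.<-irrefl refl (ℚ.<-≤-trans (ℚ.<-trans 2ca<q q<x) (begin
      ℕ→ℚ x                       ≤⟨ ℕ→ℚ-mono-≤ x≤2cf ⟩
      ℕ→ℚ (2 * c * f)             ≡⟨ ℕ→ℚ-* (2 * c) f ⟨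
      ℕ→ℚ (2 * c) ℚ.* ℕ→ℚ f       ≤⟨ *-mono-≤-nonNeg (ℕ→ℚ-nonNeg (2 * c)) ℚ.≤-refl (ℕ→ℚ-nonNeg f) f≤a ⟩
      ℕ→ℚ (2 * c) ℚ.* a           ∎))
    where
    open ℚ.≤-Reasoning
    lemma : ∀ c f → c * (f + f) ≡ 2 * c * f
    lemma = solve-∀
    x≤2cf : x ≤ 2 * c * f
    x≤2cf = ≤-trans (bound (suc f) p r Uα (<⇒≤ R^p<[1+f]^r))
      (≤-trans (*-monoʳ-≤ c (+-monoˡ-≤ f {1} {f} (s≤s z≤n))) (≤-reflexive (lemma c f)))

  -- Memory of a freshly built node

  module _ (½≤α : fromℚ ½ ≤ᶜ α) (α<1 : α <ᶜ fromℚ 1ℚ) where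

    U⇒≥½ : ∀ p r → U α (ℤ.+ suc p ℚ./ suc r) → suc r ≤ 2 * suc p
    U⇒≥½ p r Uα = ≮⇒≥ λ 2p<r → ½≤α (_ , Uα , /-mono-< (suc p) r 1 1
      (subst₂ _<_ (*-comm 2 (suc p)) (sym (*-identityˡ (suc r))) 2p<r))

    -- As α < 1, only exponents p / r ≤ 1 matter.
    PowerBound-≤1 : ∀ {x c R} → 1 ≤ R →
      (∀ N p r → U α (ℤ.+ suc p ℚ./ suc r) → p ≤ r → R ^ suc p ≤ N ^ suc r → x ≤ c * N) →
      PowerBound x c R
    PowerBound-≤1 {x} {c} {R} 1≤R bound N p r Uα R^p≤N^r with p ≤? r
    ... | yes p≤r = bound N p r Uα p≤r R^p≤N^r
    -- The exponent is lowered to 1, encoded by `0` and `0`, which is still above α; `R ≤ N` follows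
    -- by taking roots.
    ... | no  p≰r = bound N 0 0 (U-closed (proj₂ (proj₂ α<1)) (proj₁ (proj₂ α<1))) z≤n (*-monoˡ-≤ 1
      (^-cancelˡ-≤ {R} {N} (suc r) (≤-trans (^-monoʳ-≤ R {{>-nonZero 1≤R}} (s≤s (≰⇒≥ p≰r))) R^p≤N^r)))

    -- The number `64 * k * N` bounds both M ^ α and √M. For the former, the exponent is at most 1,
    -- so it does not enlarge the factor `64 * k`; for the latter, it is at least ½, so `R ≤ N ^ 2`.
    fresh⇒PowerBound : ∀ {A h M k R} → IsFreshHeader α A M h → 1 ≤ k → 1 ≤ R → M ≤ 64 * k * R →
      PowerBound (length (ID h) + aux h) ((64 + A * 64) * k) R
    fresh⇒PowerBound {A} {h} {M} {k} {R} fresh 1≤k 1≤R M≤64kR =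
      PowerBound-≤1 {c = (64 + A * 64) * k} 1≤R λ N p r Uα p≤r R^p≤N^r →
        let
          1≤N : 1 ≤ N
          1≤N = 1≤^⇒1≤ N r (≤-trans (m^n>0 R {{>-nonZero 1≤R}} (suc p)) R^p≤N^r)
          R≤N² : R ≤ N ^ 2
          R≤N² = ^-cancelˡ-≤ (suc p) (begin
            R ^ suc p          ≤⟨ R^p≤N^r ⟩
            N ^ suc r          ≤⟨ ^-monoʳ-≤ N {{>-nonZero 1≤N}} (U⇒≥½ p r Uα) ⟩
            N ^ (2 * suc p)    ≡⟨ ^-*-assoc N 2 (suc p) ⟨
            (N ^ 2) ^ suc p    ∎)
          2≤64k : 2 ≤ 64 * k
          2≤64k = *-mono-≤ {2} {64} (m≤m+n 2 62) 1≤k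
          M^p≤ : M ^ suc p ≤ (64 * k * N) ^ suc r
          M^p≤ = begin
            M ^ suc p                       ≤⟨ ^-monoˡ-≤ (suc p) M≤64kR ⟩
            (64 * k * R) ^ suc p            ≡⟨ ^-distribʳ-* (64 * k) R (suc p) ⟩
            (64 * k) ^ suc p * R ^ suc p    ≤⟨ *-mono-≤ (^-monoʳ-≤ (64 * k) {{>-nonZero (<⇒≤ 2≤64k)}} (s≤s p≤r)) R^p≤N^r ⟩
            (64 * k) ^ suc r * N ^ suc r    ≡⟨ ^-distribʳ-* (64 * k) N (suc r) ⟨
            (64 * k * N) ^ suc r            ∎
          1≤64kN² : 1 ≤ 64 * k * N ^ 2
          1≤64kN² = *-mono-≤ (<⇒≤ 2≤64k) (m^n>0 N {{>-nonZero 1≤N}} 2)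
          M< : M < 64 * k * N * (64 * k * N)
          -- The square root bound needs strictness, which comes from the spare factor `64 * k ≥ 2`.
          M< = begin-strict
            M                              ≤⟨ M≤64kR ⟩
            64 * k * R                     ≤⟨ *-monoʳ-≤ (64 * k) R≤N² ⟩
            64 * k * N ^ 2                 <⟨ m<m*n (64 * k * N ^ 2) (64 * k) {{>-nonZero 1≤64kN²}} 2≤64k ⟩
            64 * k * N ^ 2 * (64 * k)      ≡⟨ lemma₁ (64 * k) N ⟩
            64 * k * N * (64 * k * N)      ∎
        in begin
          length (ID h) + aux h
            ≤⟨ +-mono-≤ (ceiling≤ {M} (64 * k * N) p r ID-size Uα (*-mono-≤ (<⇒≤ 2≤64k) 1≤N) M^p≤)
                        (≤ᶜA·√⇒≤A*b {A = A} {M} (64 * k * N) aux-≤ M<) ⟩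
          64 * k * N + A * (64 * k * N)
            ≡⟨ lemma₂ A k N ⟩
          (64 + A * 64) * k * N ∎
      where
      open IsFreshHeader fresh
      open ≤-Reasoning
      lemma₁ : ∀ c n → c * (n * (n * 1)) * c ≡ c * n * (c * n)
      lemma₁ = solve-∀
      lemma₂ : ∀ a k n → 64 * k * n + a * (64 * k * n) ≡ (64 + a * 64) * k * n
      lemma₂ = solve-∀

    -- The invariant and its preservation

    module _ (A B : ℕ) where

      -- The first summand pays for nodes made by a rebuild, `B` for those attached by an insertion.
      K : ℕ
      K = (64 + A * 64) + B

      -- Only the representatives of a node are mentioned, and these are
      -- neither removed nor made lighter until the node itself is rebuilt.
      mutual
        Inv : Tree → Set
        Inv empty      = ⊤
        Inv (node h s) =
          1 ≤ repWeight s × PowerBound (length (ID h) + aux h) (K * numReps s) (repWeight s) × Invˢ s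

        Invˢ : Slots → Set
        Invˢ (last t)    = Inv t
        Invˢ (t ◂ _ ▸ s) = Inv t × Invˢ s

      mutual
        idealSAIT⇒Inv : ∀ t → IsGSAT √_ t → IsIdeal √_ t → AllFresh α A t → Inv t
        idealSAIT⇒Inv empty      _                  _     _               = tt
        idealSAIT⇒Inv (node h s) (1≤k , _ , gsat) ideal (fresh , freshˢ) =
          1≤R ,
          PowerBound-monoˡ {c = (64 + A * 64) * numReps s} {R = repWeight s} (*-monoˡ-≤ (numReps s) (m≤m+n (64 + A * 64) B))
            (fresh⇒PowerBound fresh 1≤k 1≤R (ideal⇒total≤ s gsat 1≤k ideal)) ,
          idealSAIT⇒Invˢ s gsat ideal freshˢ
          where
          1≤R = ≤-trans 1≤k (numReps≤repWeight s gsat)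

        idealSAIT⇒Invˢ : ∀ {M} s → IsGSATˢ √_ s → IsIdealˢ √_ M s → AllFreshˢ α A s → Invˢ s
        idealSAIT⇒Invˢ (last t)    g                   (_ , i)      f        = idealSAIT⇒Inv t g i f
        idealSAIT⇒Invˢ (t ◂ _ ▸ s) (g , _ , _ , _ , gˢ) (_ , i , iˢ) (f , fˢ) =
          idealSAIT⇒Inv t g i f , idealSAIT⇒Invˢ s gˢ iˢ fˢ

      -- With a single representative of weight 1, every admissible `N` is at least 1, so the
      -- constant size fits.
      newNode⇒Inv : ∀ {x v} → IsNewNode B x v → Inv v
      newNode⇒Inv (newNode _ _ size≤B) = ≤-refl , bound , tt , tt
        where
        bound : PowerBound _ (K * 1) 1
        bound N p r _ 1≤N^r = ≤-trans size≤B (≤-trans (m≤n+m B (64 + A * 64)) (≤-trans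
          (≤-reflexive (sym (*-identityʳ K)))
          (m≤m*n (K * 1) N {{>-nonZero (1≤^⇒1≤ N r (subst (_≤ N ^ suc r) (^-zeroˡ (suc p)) 1≤N^r))}})))

      mutual
        walk-Inv : ∀ κ x {v} t → Inv v → Inv t → Inv (walk (κ , x) v t)
        walk-Inv insert x empty      iv _ = iv
        walk-Inv delete x empty      iv _ = tt
        walk-Inv get    x empty      iv _ = tt
        walk-Inv insert x (node h s) iv i = walk-node-Inv insert x h s iv i
        walk-Inv delete x (node h s) iv i = walk-node-Inv delete x h s iv i
        walk-Inv get    x (node h s) iv i = walk-node-Inv get x h s iv i

        -- A visit alters only the counter, so the memory of the node and its number of
        -- representatives stay while their weight can only grow.
        walk-node-Inv : ∀ κ x {v} h s → Inv v → Inv (node h s) → Inv (node (visit h) (walkˢ (κ , x) v s))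
        walk-node-Inv κ x {v} h s iv (1≤R , bound , iˢ)
          rewrite numReps-walkˢ (κ , x) v s =
          ≤-trans 1≤R R≤ , PowerBound-monoʳ {c = K * numReps s} R≤ bound , walkˢ-Inv κ x s iv iˢ
          where
          R≤ = repWeight-walkˢ (κ , x) v s

        walkˢ-Inv : ∀ κ x {v} s → Inv v → Invˢ s → Invˢ (walkˢ (κ , x) v s)
        walkˢ-Inv κ x (last t)    iv i        = walk-Inv κ x t iv i
        walkˢ-Inv κ x (t ◂ e ▸ s) iv (i , iˢ) with ℤ.<-cmp x (key e)
        ... | tri< _ _ _ = walk-Inv κ x t iv i , iˢ
        ... | tri≈ _ _ _ = i , iˢ
        ... | tri> _ _ _ = i , walkˢ-Inv κ x s iv iˢ

      mutual
        -- A rebuilt subtree has the invariant as an ideal SAIT. Its ancestors keep their headers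
        -- and representatives, so their bounds carry over.
        rebalance-Inv : ∀ {x t t′} → Rebalance α A x t t′ → Inv t → Inv t′
        rebalance-Inv stop i = tt
        rebalance-Inv (rebuild {t′ = t′} _ ρ) _ = idealSAIT⇒Inv t′ gsat ideal fresh
          where open IsIdealSAIT (IsRebuildOf.idealSAIT ρ)
        rebalance-Inv (descend _ ρ) (1≤R , bound , iˢ)
          rewrite numReps-rebalanceˢ ρ | repWeight-rebalanceˢ ρ = 1≤R , bound , rebalanceˢ-Inv ρ iˢ

        rebalanceˢ-Inv : ∀ {x s s′} → Rebalanceˢ α A x s s′ → Invˢ s → Invˢ s′
        rebalanceˢ-Inv (last ρ)    i        = rebalance-Inv ρ i
        rebalanceˢ-Inv (left _ ρ)  (i , iˢ) = rebalance-Inv ρ i , iˢ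
        rebalanceˢ-Inv (found _)   i        = i
        rebalanceˢ-Inv (right _ ρ) (i , iˢ) = i , rebalanceˢ-Inv ρ iˢ

      run-Inv : ∀ {ops t t′} → Run α A B ops t t′ → Inv t → Inv t′
      run-Inv []       i = i
      run-Inv (_∷_ {t = t} (step {κ = κ} {x = x} new ρ) run) i =
        run-Inv run (rebalance-Inv ρ (walk-Inv κ x t (newNode⇒Inv new) i))

      -- Summation over the tree

      module _ (N p r : ℕ) (Uα : U α (ℤ.+ suc p ℚ./ suc r)) where

        open ≤-Reasoning

        mutual
          -- One `N` chosen for the whole tree serves every node, because subtrees and sets of
          -- representatives weigh no more than the tree.
          memory≤ : ∀ t → Inv t → m⟨ t ⟩ ^ suc p ≤ N ^ suc r → memory t ≤ K * numKeys t * N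
          memory≤ empty      _               _       = z≤n
          memory≤ (node h s) (_ , bound , i) m^p≤N^r = begin
            length (ID h) + aux h + memoryˢ s
              ≤⟨ +-monoˡ-≤ (memoryˢ s) (bound N p r Uα (≤-trans (^-monoˡ-≤ (suc p) (repWeight≤total s)) m^p≤N^r)) ⟩
            K * numReps s * N + memoryˢ s
              ≤⟨ memoryˢ≤ s i m^p≤N^r ⟩
            K * length (entriesˢ s) * N ∎

          -- The added term is the memory allowance of the enclosing node. It is charged to its
          -- representatives, `K * N` each, so that each key pays exactly once.
          memoryˢ≤ : ∀ s → Invˢ s → total (entriesˢ s) ^ suc p ≤ N ^ suc r →
            K * numReps s * N + memoryˢ s ≤ K * length (entriesˢ s) * N
          memoryˢ≤ (last t) i m^p≤N^r rewrite *-zeroʳ K = memory≤ t i m^p≤N^r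
          memoryˢ≤ (t ◂ e ▸ s) (i , iˢ) m^p≤N^r
            rewrite total-++ (entries t) (e ∷ entriesˢ s) | length-++ (entries t) {e ∷ entriesˢ s} = begin
            K * suc (numReps s) * N + (memory t + memoryˢ s)
              ≡⟨ lemma₁ K (numReps s) N (memory t) (memoryˢ s) ⟩
            memory t + (K * N + (K * numReps s * N + memoryˢ s))
              ≤⟨ +-mono-≤
                   (memory≤ t i (≤-trans (^-monoˡ-≤ (suc p) (m≤m+n m⟨ t ⟩ _)) m^p≤N^r))
                   (+-monoʳ-≤ (K * N) (memoryˢ≤ s iˢ (≤-trans
                     (^-monoˡ-≤ (suc p) (≤-trans (m≤n+m _ (ac e)) (m≤n+m _ m⟨ t ⟩))) m^p≤N^r))) ⟩
            K * numKeys t * N + (K * N + K * length (entriesˢ s) * N)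
              ≡⟨ lemma₂ K (numKeys t) N (length (entriesˢ s)) ⟩
            K * (numKeys t + suc (length (entriesˢ s))) * N ∎
            where
            lemma₁ : ∀ c k n a b → c * suc k * n + (a + b) ≡ a + (c * n + (c * k * n + b))
            lemma₁ = solve-∀
            lemma₂ : ∀ c a n b → c * a * n + (c * n + c * b * n) ≡ c * (a + suc b) * n
            lemma₂ = solve-∀

      Inv⇒memory≤ᶜ : ∀ t → Inv t → fromℕ (memory t) ≤ᶜ (2 * K * numKeys t) ·ᶜ (m⟨ t ⟩ ^ᶜ α)
      -- The weight is 0 here, outside the range of `PowerBound⇒≤ᶜ`; but a refutation would need
      -- `0 < q` and `q < 0`.
      Inv⇒memory≤ᶜ empty _ (q , (a , _ , 0<q) , q<0) = ℚ.<-irrefl refl (ℚ.<-trans q<0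
        (subst (ℚ._< q) (trans (cong (λ c → ℕ→ℚ c ℚ.* a) (*-zeroʳ (2 * K))) (ℚ.*-zeroˡ a)) 0<q))
      Inv⇒memory≤ᶜ t@(node h s) i =
        subst (λ c → fromℕ (memory t) ≤ᶜ c ·ᶜ (m⟨ t ⟩ ^ᶜ α)) (sym (*-assoc 2 K (numKeys t)))
          (PowerBound⇒≤ᶜ {c = K * numKeys t} (≤-trans (proj₁ i) (repWeight≤total s))
            λ N p r Uα → memory≤ N p r Uα t i)

theorem6 : (α : Cut) → IsReal α → fromℚ ½ ≤ᶜ α → α <ᶜ fromℚ 1ℚ →
    (A B : ℕ) →
    ∃[ K ] (∀ (T₀ T : Tree) (ops : List Operation) →
    IsInitial α A T₀ → Run α A B ops T₀ T →
    fromℕ (memory T) ≤ᶜ (K * numKeys T) ·ᶜ (m⟨ T ⟩ ^ᶜ α))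
theorem6 α real ½≤α α<1 A B = 2 * K α real ½≤α α<1 A B , λ T₀ T ops (sait , _) run →
  let open IsIdealSAIT sait in
  Inv⇒memory≤ᶜ α real ½≤α α<1 A B T
    (run-Inv α real ½≤α α<1 A B run (idealSAIT⇒Inv α real ½≤α α<1 A B T₀ gsat ideal fresh))
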